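{- For every integer $t\ge 9$, there is a family of three trees $\{T_1,T_2,T_3\}$, each with $2t^3+2$ vertices and with pathwidth two, such that no isometric-universal graph for $\{T_1,T_2,T_3\}$ that is a tree is minimum; that is, every isometric-universal tree for $\{T_1,T_2,T_3\}$ has strictly more vertices than a minimum isometric-universal graph for $\{T_1,T_2,T_3\}$.
   Context: For vertices $u,v$ of a graph $G$, $\mathrm{dist}_G(u,v)$ is the number of edges of a shortest $u$–$v$ path in $G$, and $\infty$ if no such path exists. A subgraph $H$ of $G$ is an isometric subgraph if $\mathrm{dist}_H(u,v)=\mathrm{dist}_G(u,v)$ for all vertices $u,v$ of $H$. A graph $\mathcal{U}$ is an isometric-universal graph for a family $\mathcal{F}$ of graphs if every graph of $\mathcal{F}$ is isomorphic to an isometric subgraph of $\mathcal{U}$; it is minimum if it has the smallest possible number of vertices among all isometric-universal graphs for $\mathcal{F}$. An isometric-universal tree is an isometric-universal graph that is a tree. -}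

module Defs where

open import Data.Nat using (ℕ; zero; suc; _+_; _≤_; _<_; _∸_)
open import Data.Fin using (Fin; zero; suc; inject₁; fromℕ) renaming (_≤_ to _≤ᶠ_)
open import Data.Fin.Subset using (Subset; _∈_; ∣_∣)
open import Data.Bool using (Bool; true; false)
open import Data.Vec using (Vec; lookup)
open import Data.Product using (Σ; Σ-syntax; ∃; ∃-syntax; _×_; _,_)
open import Relation.Binary.PropositionalEquality using (_≡_; _≢_)
open import Relation.Nullary using (¬_)
open import Function.Definitions using (Injective)
open import Function.Bundles using (_⇔_)

record Graph (n : ℕ) : Set where
  field
    adj   : Fin n → Fin n → Bool
    sym   : ∀ u v → adj u v ≡ adj v u
    irrfl : ∀ u → adj u u ≡ false

open Graph public

Adj : ∀ {n} → Graph n → Fin n → Fin n → Set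
Adj G u v = adj G u v ≡ true

data Walk {n : ℕ} (G : Graph n) : Fin n → Fin n → ℕ → Set where
  nil  : ∀ {u} → Walk G u u 0
  cons : ∀ {u w v k} → Adj G u w → Walk G w v k → Walk G u v (suc k)

-- dist_G(u,v) = d  (finite value d).  dist_G(u,v) = ∞ corresponds to there
-- being no d with Dist G u v d.
Dist : ∀ {n} → Graph n → Fin n → Fin n → ℕ → Set
Dist G u v d = Walk G u v d × (∀ k → k < d → ¬ Walk G u v k)

-- H is isomorphic to an isometric subgraph of G, witnessed by an injective
-- vertex map f that sends edges to edges and preserves all distances
-- (including the value ∞, since Dist holds for no d in both or neither).
record IsometricEmbedding {m n : ℕ} (H : Graph m) (G : Graph n) : Set where
  field
    f        : Fin m → Fin n
    f-inj    : Injective _≡_ _≡_ f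
    f-edge   : ∀ u v → Adj H u v → Adj G (f u) (f v)
    f-dist   : ∀ u v d → Dist H u v d ⇔ Dist G (f u) (f v) d

IsIsoUniversal : ∀ {I : Set} {sz : I → ℕ} → ((i : I) → Graph (sz i)) →
                 ∀ {n} → Graph n → Set
IsIsoUniversal F U = ∀ i → IsometricEmbedding (F i) U

IsMinimumIsoUniversal : ∀ {I : Set} {sz : I → ℕ} → ((i : I) → Graph (sz i)) →
                        ∀ {n} → Graph n → Set
IsMinimumIsoUniversal F {n} U =
  IsIsoUniversal F U × (∀ m (G : Graph m) → IsIsoUniversal F G → n ≤ m)

Connected : ∀ {n} → Graph n → Set
Connected G = ∀ u v → ∃[ k ] Walk G u v k

record Cycle {n : ℕ} (G : Graph n) : Set where
  field
    len      : ℕ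
    c        : Fin (suc (suc (suc len))) → Fin n
    c-inj    : Injective _≡_ _≡_ c
    c-edges  : ∀ (i : Fin (suc (suc len))) → Adj G (c (inject₁ i)) (c (suc i))
    c-close  : Adj G (c (fromℕ (suc (suc len)))) (c zero)

Acyclic : ∀ {n} → Graph n → Set
Acyclic G = ¬ Cycle G

IsTree : ∀ {n} → Graph n → Set
IsTree {n} G = 0 < n × Connected G × Acyclic G

record PathDecomposition {n : ℕ} (G : Graph n) : Set where
  field
    r          : ℕ
    bag        : Fin r → Subset n
    cover-v    : ∀ v → ∃[ i ] v ∈ bag i
    cover-e    : ∀ u v → Adj G u v → ∃[ i ] (u ∈ bag i × v ∈ bag i)
    interval   : ∀ v (i j k : Fin r) → i ≤ᶠ j → j ≤ᶠ k →
                 v ∈ bag i → v ∈ bag k → v ∈ bag j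

WidthAtMost : ∀ {n} {G : Graph n} → PathDecomposition G → ℕ → Set
WidthAtMost D w = ∀ i → ∣ PathDecomposition.bag D i ∣ ≤ suc w

Pathwidth : ∀ {n} → Graph n → ℕ → Set
Pathwidth G w =
  (Σ[ D ∈ PathDecomposition G ] WidthAtMost D w) ×
  (∀ (D : PathDecomposition G) w' → WidthAtMost D w' → w ≤ w')

{-# OPTIONS --safe #-}

-- Each of the three trees consists of two hubs with L = t³ - 5 leaves each, at distance 2, 3 and 4
-- respectively, plus a bounded number of vertices. Since 2 + 3 + 4 = 9, the hubs of all three can be
-- placed on just three vertices of a 9-cycle, which gives an isometric-universal graph with about 3L
-- vertices. A tree has no odd cycle, so there the three distances force four distinct hubs, and
-- these pairwise share at most one neighbour: at least 4L - 6 vertices. A minimum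
-- isometric-universal graph is found constructively, by searching all smaller graphs. Pathwidth two
-- comes from sweeping each tree with bags of three vertices, and from a spider with three legs of
-- length two.

module Submission where

open import Defs hiding (sym)
open import Data.Bool using (Bool; true; false; not; _∧_; _∨_) renaming (_≟_ to _≟ᵇ_)
open import Data.Bool.Properties using (∧-comm; ∧-zeroʳ; ∧-identityʳ; ∧-idem)
open import Data.Empty using (⊥-elim)
open import Data.Nat using (ℕ; zero; suc; _+_; _*_; _^_; _∸_; _≤_; _<_; _≡ᵇ_; z≤n; s≤s; parity)
open import Data.Nat.DivMod using (_%_; _mod_)
import Data.Nat.Properties as ℕₚ
open import Data.Nat.Solver using (module +-*-Solver)
open import Data.Parity using (Parity; 0ℙ; 1ℙ) renaming (_+_ to _ℙ+_)
import Data.Parity.Properties as Parityₚ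
open import Data.Fin using (Fin; zero; suc; toℕ; inject₁; fromℕ; #_) renaming (_≤_ to _≤ᶠ_)
import Data.Fin.Properties as Finₚ
open import Data.Fin.Properties using (_≟_; any?; all?)
open import Data.Fin.Subset using (Subset; ∣_∣; inside; outside; ⁅_⁆; _∪_; _-_; ⊤) renaming (_∈_ to _∈ₛ_)
import Data.Fin.Subset.Properties as Subₚ
open import Data.List using (List; []; _∷_; length; map; filter; _++_)
open import Data.List.Relation.Unary.Any using (Any; here; there)
import Data.List.Properties as Listₚ
open import Data.List.Relation.Unary.All as All using (All; []; _∷_)
import Data.List.Relation.Unary.All.Properties as Allₚ
open import Data.List.Relation.Unary.AllPairs using ([]; _∷_)
open import Data.List.Relation.Unary.Unique.Propositional using (Unique)
import Data.List.Relation.Unary.Unique.Propositional.Properties as Uniqueₚ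
open import Data.Product using (Σ-syntax; ∃; ∃-syntax; _×_; _,_; proj₁; proj₂)
open import Data.Fin.Relation.Unary.Top using (view; ‵fromℕ; ‵inject₁)
import Data.Unit
open import Data.Sum using (_⊎_; inj₁; inj₂)
open import Data.Vec using (Vec; []; _∷_; lookup; tabulate; here; there)
import Data.Vec.Properties as Vecₚ
open import Function using (_∘_; id; mk⇔; Equivalence)
open import Relation.Binary.PropositionalEquality
  using (_≡_; _≢_; refl; sym; trans; cong; cong₂; subst; subst₂)
open import Relation.Nullary using (¬_; Dec; yes; no; does; contradiction)
open import Relation.Nullary.Decidable
  using (¬?; map′; _×-dec_; _⊎-dec_; _→-dec_; from-yes; True; toWitness; dec-true)
open import Relation.Binary.Definitions using (tri<; tri≈; tri>)

open IsometricEmbedding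

private
  variable
    k l m n : ℕ

-- Walks and distances

adj-sym : ∀ (G : Graph n) {u v} → Adj G u v → Adj G v u
adj-sym G {u} {v} e = trans (sym (Graph.sym G u v)) e

adj-irrefl : ∀ (G : Graph n) {u v} → Adj G u v → u ≢ v
adj-irrefl G {u} e refl with trans (sym (irrfl G u)) e
... | ()

_++ʷ_ : ∀ {G : Graph n} {u v w} → Walk G u v k → Walk G v w l → Walk G u w (k + l)
nil       ++ʷ q = q
cons e p  ++ʷ q = cons e (p ++ʷ q)

reverseʷ : ∀ {G : Graph n} {u v} → Walk G u v k → Walk G v u k
reverseʷ nil = nil
reverseʷ {G = G} (cons {k = k} e p) =
  subst (Walk G _ _) (ℕₚ.+-comm k 1) (reverseʷ p ++ʷ cons (adj-sym G e) nil)

mapʷ : ∀ {G : Graph m} {H : Graph n} (f : Fin m → Fin n) →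
       (∀ {u v} → Adj G u v → Adj H (f u) (f v)) →
       ∀ {u v} → Walk G u v k → Walk H (f u) (f v) k
mapʷ f h nil        = nil
mapʷ f h (cons e p) = cons (h e) (mapʷ f h p)

shrinkʷ : ∀ {G : Graph m} {H : Graph n} (f : Fin m → Fin n) →
          (∀ {u v} → Adj G u v → f u ≡ f v ⊎ Adj H (f u) (f v)) →
          ∀ {u v} → Walk G u v k → ∃[ j ] (j ≤ k × Walk H (f u) (f v) j)
shrinkʷ f h nil = 0 , z≤n , nil
shrinkʷ {H = H} f h {v = v} (cons e p) with shrinkʷ f h p | h e
... | j , j≤k , q | inj₁ eq = j , ℕₚ.m≤n⇒m≤1+n j≤k , subst (λ x → Walk H x (f v) j) (sym eq) q
... | j , j≤k , q | inj₂ e′ = suc j , s≤s j≤k , cons e′ q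

Dist-unique : ∀ {G : Graph n} {u v d e} → Dist G u v d → Dist G u v e → d ≡ e
Dist-unique {d = d} {e} (p , p-min) (q , q-min) with ℕₚ.<-cmp d e
... | tri< d<e _ _ = contradiction p (q-min d d<e)
... | tri≈ _ d≡e _ = d≡e
... | tri> _ _ e<d = contradiction q (p-min e e<d)

Dist-sym : ∀ {G : Graph n} {u v d} → Dist G u v d → Dist G v u d
Dist-sym (p , p-min) = reverseʷ p , λ j j<d q → p-min j j<d (reverseʷ q)

walk? : ∀ (G : Graph n) u v k → Dec (Walk G u v k)
walk? G u v zero    = map′ (λ { refl → nil }) (λ { nil → refl }) (u ≟ v)
walk? G u v (suc k) = map′ (λ { (w , e , p) → cons e p }) (λ { (cons e p) → _ , e , p })
  (any? λ w → (adj G u w ≟ᵇ true) ×-dec walk? G w v k)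

dist? : ∀ (G : Graph n) u v d → Dec (Dist G u v d)
dist? G u v d = walk? G u v d ×-dec
  map′ (λ h j j<d → h j<d) (λ h {j} → h j) (ℕₚ.allUpTo? (λ j → ¬? (walk? G u v j)) d)

-- The given instance at `b` bounds the search. This yields both distances and the order of a
-- minimum universal graph.
least : ∀ {P : ℕ → Set} → (∀ i → Dec (P i)) → ∀ {b} → P b →
        Σ[ i ∈ ℕ ] (P i × (∀ j → j < i → ¬ P j))
least P? {zero} pb = 0 , pb , λ _ ()
least {P} P? {suc b} pb with P? 0
... | yes p0 = 0 , p0 , λ _ ()
... | no ¬p0 with least (P? ∘ suc) pb
...   | i , pi , i-min = suc i , pi , λ { zero _ → ¬p0 ; (suc j) (s≤s j<i) → i-min j j<i }

distance : ∀ {G : Graph n} → Connected G → ∀ u v → Σ[ d ∈ ℕ ] Dist G u v d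
distance {G = G} conn u v = least (walk? G u v) (proj₂ (conn u v))

embedding-∘ : ∀ {G : Graph k} {H : Graph m} {K : Graph n} →
              IsometricEmbedding H K → IsometricEmbedding G H → IsometricEmbedding G K
embedding-∘ β α .f      = f β ∘ f α
embedding-∘ β α .f-inj  = f-inj α ∘ f-inj β
embedding-∘ β α .f-edge u v e = f-edge β _ _ (f-edge α u v e)
embedding-∘ β α .f-dist u v d = mk⇔ (to (f-dist β _ _ d) ∘ to (f-dist α u v d))
                                    (from (f-dist α u v d) ∘ from (f-dist β _ _ d))
  where open Equivalence

-- Weak retractions, and adding a pendant vertex

-- The retraction may contract edges; since it never lengthens a walk, ι is isometric.
record Retract (H : Graph m) (G : Graph n) : Set where
  field
    ι      : Fin m → Fin n
    ρ      : Fin n → Fin m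
    ρ∘ι    : ∀ u → ρ (ι u) ≡ u
    ι-edge : ∀ u v → Adj H u v → Adj G (ι u) (ι v)
    ρ-edge : ∀ x y → Adj G x y → ρ x ≡ ρ y ⊎ Adj H (ρ x) (ρ y)

open Retract

Retract⇒embedding : ∀ {H : Graph m} {G : Graph n} → Retract H G → IsometricEmbedding H G
Retract⇒embedding {H = H} {G} R = record
  { f = ι R
  ; f-inj = λ {x} {y} eq → trans (sym (ρ∘ι R x)) (trans (cong (ρ R) eq) (ρ∘ι R y))
  ; f-edge = ι-edge R
  ; f-dist = λ u v d → mk⇔ (to u v d) (from u v d)
  }
  where
  up : ∀ {u v j} → Walk H u v j → Walk G (ι R u) (ι R v) j
  up = mapʷ (ι R) (ι-edge R _ _)
  down : ∀ {u v j} → Walk G (ι R u) (ι R v) j → ∃[ i ] (i ≤ j × Walk H u v i)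
  down {u} {v} p with shrinkʷ {H = H} (ρ R) (ρ-edge R _ _) p
  ... | i , i≤j , q = i , i≤j , subst₂ (λ x y → Walk H x y i) (ρ∘ι R u) (ρ∘ι R v) q
  to : ∀ u v d → Dist H u v d → Dist G (ι R u) (ι R v) d
  to u v d (p , p-min) = up p , λ j j<d q →
    let i , i≤j , q′ = down q in p-min i (ℕₚ.≤-<-trans i≤j j<d) q′
  from : ∀ u v d → Dist G (ι R u) (ι R v) d → Dist H u v d
  from u v d (p , p-min) with down p
  -- A projected walk shorter than `d` would lift back along `ι` and contradict minimality in `G`,
  -- so the projection has length exactly `d`.
  ... | i , i≤d , q with ℕₚ.m≤n⇒m<n∨m≡n i≤d
  ...   | inj₁ i<d  = contradiction (up q) (p-min i i<d)
  ...   | inj₂ refl = q , λ j j<d q′ → p-min j j<d (up q′)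

module _ (G : Graph n) (a : Fin n) where

  pendAdj : Fin (suc n) → Fin (suc n) → Bool
  pendAdj zero    zero    = false
  pendAdj zero    (suc v) = does (v ≟ a)
  pendAdj (suc u) zero    = does (u ≟ a)
  pendAdj (suc u) (suc v) = adj G u v

  pend : Graph (suc n)
  pend .adj   = pendAdj
  pend .Graph.sym zero    zero    = refl
  pend .Graph.sym zero    (suc v) = refl
  pend .Graph.sym (suc u) zero    = refl
  pend .Graph.sym (suc u) (suc v) = Graph.sym G u v
  pend .irrfl zero    = refl
  pend .irrfl (suc u) = irrfl G u

does⇒≡ : ∀ {u v : Fin n} → does (u ≟ v) ≡ true → u ≡ v
does⇒≡ {u = u} {v} eq with u ≟ v
... | yes u≡v = u≡v
does⇒≡ () | no _

pend-edge : ∀ (G : Graph n) a → Adj (pend G a) zero (suc a)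
pend-edge G a = dec-true (a ≟ a) refl

pend-edge′ : ∀ (G : Graph n) a → Adj (pend G a) (suc a) zero
pend-edge′ G a = dec-true (a ≟ a) refl

retract-refl : (G : Graph n) → Retract G G
retract-refl G = record
  { ι = id ; ρ = id ; ρ∘ι = λ _ → refl ; ι-edge = λ _ _ → id ; ρ-edge = λ _ _ → inj₂ }

-- The new vertex retracts onto the image of its neighbour, contracting the pendant edge.
retract-pendʳ : ∀ {H : Graph m} {G : Graph n} → Retract H G → ∀ b → Retract H (pend G b)
retract-pendʳ {H = H} {G} R b = record
  { ι = suc ∘ ι R ; ρ = ρ′ ; ρ∘ι = ρ∘ι R ; ι-edge = ι-edge R ; ρ-edge = ρ-edge′ }
  where
  ρ′ : Fin (suc _) → Fin _
  ρ′ zero    = ρ R b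
  ρ′ (suc x) = ρ R x
  ρ-edge′ : ∀ x y → Adj (pend G b) x y → ρ′ x ≡ ρ′ y ⊎ Adj H (ρ′ x) (ρ′ y)
  ρ-edge′ zero    (suc y) e = inj₁ (cong (ρ R) (sym (does⇒≡ e)))
  ρ-edge′ (suc x) zero    e = inj₁ (cong (ρ R) (does⇒≡ e))
  ρ-edge′ (suc x) (suc y) e = ρ-edge R x y e

retract-pend : ∀ {H : Graph m} {G : Graph n} (R : Retract H G) {a b} → ι R a ≡ b →
               Retract (pend H a) (pend G b)
retract-pend {H = H} {G} R {a} {b} ιa≡b = record
  { ι = ι′ ; ρ = ρ′ ; ρ∘ι = ρ∘ι′ ; ι-edge = ι-edge′ ; ρ-edge = ρ-edge′ }
  where
  ρb≡a : ρ R b ≡ a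
  ρb≡a = trans (cong (ρ R) (sym ιa≡b)) (ρ∘ι R a)
  ι′ : Fin (suc _) → Fin (suc _)
  ι′ zero    = zero
  ι′ (suc u) = suc (ι R u)
  ρ′ : Fin (suc _) → Fin (suc _)
  ρ′ zero    = zero
  ρ′ (suc x) = suc (ρ R x)
  ρ∘ι′ : ∀ u → ρ′ (ι′ u) ≡ u
  ρ∘ι′ zero    = refl
  ρ∘ι′ (suc u) = cong suc (ρ∘ι R u)
  ι-edge′ : ∀ u v → Adj (pend H a) u v → Adj (pend G b) (ι′ u) (ι′ v)
  ι-edge′ zero    (suc v) e = dec-true (_ ≟ _) (trans (cong (ι R) (does⇒≡ e)) ιa≡b)
  ι-edge′ (suc u) zero    e = dec-true (_ ≟ _) (trans (cong (ι R) (does⇒≡ e)) ιa≡b)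
  ι-edge′ (suc u) (suc v) e = ι-edge R u v e
  ρ-edge′ : ∀ x y → Adj (pend G b) x y → ρ′ x ≡ ρ′ y ⊎ Adj (pend H a) (ρ′ x) (ρ′ y)
  ρ-edge′ zero    (suc y) e = inj₂ (dec-true (_ ≟ _) (trans (cong (ρ R) (does⇒≡ e)) ρb≡a))
  ρ-edge′ (suc x) zero    e = inj₂ (dec-true (_ ≟ _) (trans (cong (ρ R) (does⇒≡ e)) ρb≡a))
  ρ-edge′ (suc x) (suc y) e with ρ-edge R x y e
  ... | inj₁ eq = inj₁ (cong suc eq)
  ... | inj₂ e′ = inj₂ e′

-- Trees

pend-connected : ∀ {G : Graph n} {a} → Connected G → Connected (pend G a)
pend-connected {G = G} {a} conn zero    zero    = 0 , nil
pend-connected {G = G} {a} conn zero    (suc v) =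
  _ , cons (pend-edge G a) (mapʷ suc id (proj₂ (conn a v)))
pend-connected {G = G} {a} conn (suc u) zero    =
  _ , (mapʷ suc id (proj₂ (conn u a)) ++ʷ cons (pend-edge′ G a) nil)
pend-connected {G = G} {a} conn (suc u) (suc v) = _ , mapʷ suc id (proj₂ (conn u v))

-- A pendant vertex has a single neighbour, so this keeps it off every cycle. The last position is
-- treated apart because the closing edge is stored separately.
cycle-neighbours : ∀ {G : Graph n} (C : Cycle G) i → let open Cycle C in
                   ∃[ x ] ∃[ y ] (x ≢ y × Adj G (c i) x × Adj G (c i) y)
cycle-neighbours {G = G} C zero = c (suc zero) , c (fromℕ _) , x≢y , c-edges zero , adj-sym G c-close
  where
  open Cycle C
  x≢y : c (suc zero) ≢ c (fromℕ (suc (suc len)))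
  x≢y eq with c-inj eq
  ... | ()
cycle-neighbours {G = G} C (suc j) with view j
... | ‵fromℕ = c (inject₁ (fromℕ _)) , c zero , x≢y , adj-sym G (c-edges (fromℕ _)) , c-close
  where
  open Cycle C
  x≢y : c (inject₁ (fromℕ (suc len))) ≢ c zero
  x≢y eq with c-inj eq
  ... | ()
... | ‵inject₁ i = c (inject₁ (inject₁ i)) , c (suc (suc i)) , x≢y ,
                   adj-sym G (c-edges (inject₁ i)) , c-edges (suc i)
  where
  open Cycle C
  x≢y : c (inject₁ (inject₁ i)) ≢ c (suc (suc i))
  x≢y eq = ℕₚ.m≢1+m+n (toℕ i) {1} (trans (sym (trans (Finₚ.toℕ-inject₁ (inject₁ i)) (Finₚ.toℕ-inject₁ i)))
    (trans (cong toℕ (c-inj eq)) (cong suc (sym (ℕₚ.+-comm (toℕ i) 1)))))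

-- No cycle passes through the pendant vertex, and a cycle that avoids `zero` pulls back along
-- `suc`.
pend-acyclic : ∀ {G : Graph n} {a} → Acyclic G → Acyclic (pend G a)
pend-acyclic {G = G} {a} acyc C with any? (λ i → Cycle.c C i ≟ zero)
... | yes (i , ci≡0) with cycle-neighbours C i
...   | x , y , x≢y , e , e′ = x≢y (trans (only ci≡0 e) (sym (only ci≡0 e′)))
  where
  only : ∀ {z x} → z ≡ zero → Adj (pend G a) z x → x ≡ suc a
  only {x = zero}  refl ()
  only {x = suc x} refl e = cong suc (does⇒≡ e)
pend-acyclic {G = G} {a} acyc C | no ¬0 = acyc record
  { len     = len
  ; c       = proj₁ ∘ pred
  ; c-inj   = λ {i} {j} eq → c-inj (trans (proj₂ (pred i)) (trans (cong suc eq) (sym (proj₂ (pred j)))))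
  ; c-edges = λ i → subst₂ (Adj (pend G a)) (proj₂ (pred (inject₁ i))) (proj₂ (pred (suc i))) (c-edges i)
  ; c-close = subst₂ (Adj (pend G a)) (proj₂ (pred (fromℕ _))) (proj₂ (pred zero)) c-close
  }
  where
  open Cycle C
  pred : ∀ i → ∃[ x ] c i ≡ suc x
  pred i with c i in eq
  ... | zero  = contradiction (i , eq) ¬0
  ... | suc x = x , refl

pend-tree : ∀ {G : Graph n} a → IsTree G → IsTree (pend G a)
pend-tree a (_ , conn , acyc) = s≤s z≤n , pend-connected conn , pend-acyclic acyc

point : Graph 1
point = record { adj = λ _ _ → false ; sym = λ _ _ → refl ; irrfl = λ _ → refl }

point-tree : IsTree point
point-tree = s≤s z≤n , (λ { zero zero → 0 , nil }) , acyc
  where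
  Fin1 : (x y : Fin 1) → x ≡ y
  Fin1 zero zero = refl
  acyc : Acyclic point
  acyc C with Cycle.c-inj C (Fin1 (Cycle.c C zero) (Cycle.c C (suc zero)))
  ... | ()

-- Walks in acyclic graphs

parity-suc : ∀ k l → parity k ≡ parity l → parity (suc k) ≡ parity (suc l)
parity-suc k l eq = Parityₚ.⁻¹-injective (trans (Parityₚ.suc-homo-⁻¹ k) (trans eq (sym (Parityₚ.suc-homo-⁻¹ l))))

module _ {G : Graph n} where

  at : ∀ {u v} → Walk G u v k → Fin (suc k) → Fin n
  at {u = u} p  zero    = u
  at (cons e p) (suc i) = at p i

  at-last : ∀ {u v} (p : Walk G u v k) → at p (fromℕ k) ≡ v
  at-last nil        = refl
  at-last (cons e p) = at-last p

  at-edge : ∀ {u v} (p : Walk G u v k) i → Adj G (at p (inject₁ i)) (at p (suc i))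
  at-edge (cons e nil)        zero    = e
  at-edge (cons e (cons _ _)) zero    = e
  at-edge (cons e p)          (suc i) = at-edge p i

  Simple : ∀ {u v} → Walk G u v k → Set
  Simple nil                = Data.Unit.⊤
  Simple (cons {u = u} e p) = (∀ i → at p i ≢ u) × Simple p

  simple-injective : ∀ {u v} (p : Walk G u v k) → Simple p → ∀ {i j} → at p i ≡ at p j → i ≡ j
  simple-injective p          s        {zero}  {zero}  eq = refl
  simple-injective (cons e p) (u∉ , s) {zero}  {suc j} eq = contradiction (sym eq) (u∉ j)
  simple-injective (cons e p) (u∉ , s) {suc i} {zero}  eq = contradiction eq (u∉ i)
  simple-injective (cons e p) (u∉ , s) {suc i} {suc j} eq = cong suc (simple-injective p s eq)

  -- `⊆prefix` carries simplicity through the recursion in `split`: a vertex that `p` avoids is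
  -- avoided by the prefix too.
  record Split {u v} (p : Walk G u v k) (x : Fin n) : Set where
    field
      {a b}        : ℕ
      prefix       : Walk G u x a
      suffix       : Walk G x v b
      a+b≡k        : a + b ≡ k
      ⊆prefix      : ∀ i → ∃[ j ] at p j ≡ at prefix i
      simplePrefix : Simple p → Simple prefix
      simpleSuffix : Simple p → Simple suffix

  split : ∀ {u v} (p : Walk G u v k) i → Split p (at p i)
  split p zero = record
    { prefix = nil ; suffix = p ; a+b≡k = refl ; ⊆prefix = λ { zero → zero , refl }
    ; simplePrefix = _ ; simpleSuffix = id }
  split (cons e p) (suc i) = record
    { prefix = cons e prefix ; suffix = suffix ; a+b≡k = cong suc a+b≡k
    ; ⊆prefix = λ { zero → zero , refl ; (suc j) → let j′ , eq = ⊆prefix j in suc j′ , eq }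
    ; simplePrefix = λ { (u∉ , s) →
        (λ j eq → let j′ , eq′ = ⊆prefix j in u∉ j′ (trans eq′ eq)) , simplePrefix s }
    ; simpleSuffix = simpleSuffix ∘ proj₂ }
    where open Split (split p i)

  simple⇒cycle : ∀ {u v} (p : Walk G u v (suc (suc k))) → Simple p → Adj G v u → Cycle G
  simple⇒cycle p s e = record
    { c = at p ; c-inj = simple-injective p s ; c-edges = at-edge p
    ; c-close = subst (λ x → Adj G x _) (sym (at-last p)) e }

  -- A repeated vertex u ~ w with u on the simple path from w closes a cycle unless u is the
  -- second vertex of that path; then both ends of the detour u, w, u are dropped.
  simplify : Acyclic G → ∀ {u v} → Walk G u v k →
             Σ[ j ∈ ℕ ] Σ[ p ∈ Walk G u v j ] (Simple p × parity j ≡ parity k)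
  simplify acyc nil = 0 , nil , _ , refl
  simplify acyc (cons {u = u} {w} {v} {k} e p) with simplify acyc p
  ... | j , q , s , par with any? (λ i → at q i ≟ u)
  ...   | no  u∉q = suc j , cons e q , ((λ i eq → u∉q (i , eq)) , s) , parity-suc j k par
  ...   | yes (i , eq) = back (subst (Split q) eq (split q i))
    where
    back : Split q u → Σ[ j ∈ ℕ ] Σ[ p ∈ Walk G u v j ] (Simple p × parity j ≡ parity (suc k))
    back record { a = 0 ; prefix = nil } = contradiction refl (adj-irrefl G e)
    -- The edge `e` and the first edge of `q` disappear; `parity` reduces two successors at a time,
    -- so `suc (suc b)` has the parity of `b`.
    back record { a = 1 ; b = b ; suffix = r ; a+b≡k = refl ; simpleSuffix = σ } =
      b , r , σ s , parity-suc (suc b) k par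
    back record { a = suc (suc _) ; prefix = r ; simplePrefix = σ } =
      ⊥-elim (acyc (simple⇒cycle r (σ s) e))

  -- A simple closed walk is empty, and simplifying preserves parity.
  acyclic⇒even : Acyclic G → ∀ {u} → Walk G u u k → parity k ≡ 0ℙ
  acyclic⇒even acyc p with simplify acyc p
  ... | _ , nil      , _        , par = sym par
  ... | _ , cons {k = i} e q , (u∉ , _) , _ = contradiction (at-last q) (u∉ (fromℕ i))

-- Stars in acyclic graphs

-- `leaves` need not exhaust the neighbours of `v`, so a star survives every injective map that
-- preserves edges.
record Star (G : Graph n) (d : ℕ) (v : Fin n) : Set where
  field
    leaves   : List (Fin n)
    unique   : Unique leaves
    adjacent : All (Adj G v) leaves
    degree   : length leaves ≡ d

open Star

star-map : ∀ {G : Graph m} {H : Graph n} (φ : Fin m → Fin n) → (∀ {x y} → φ x ≡ φ y → x ≡ y) →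
           (∀ {u v} → Adj G u v → Adj H (φ u) (φ v)) → ∀ {d v} → Star G d v → Star H d (φ v)
star-map φ φ-inj φ-edge s = record
  { leaves   = map φ (leaves s)
  ; unique   = Uniqueₚ.map⁺ φ-inj (unique s)
  ; adjacent = Allₚ.map⁺ (All.map φ-edge (adjacent s))
  ; degree   = trans (Listₚ.length-map φ (leaves s)) (degree s)
  }

length≤card : ∀ {xs} (p : Subset n) → Unique xs → All (_∈ₛ p) xs → length xs ≤ ∣ p ∣
length≤card p []         []         = z≤n
length≤card p (x∉ ∷ xs!) (x∈p ∷ xs∈p) = ℕₚ.≤-trans
  (s≤s (length≤card (p - _) xs! (All.zipWith (λ { (y∈p , x≢y) → Subₚ.x∈p∧x≢y⇒x∈p-y y∈p (x≢y ∘ sym) }) (xs∈p , x∉))))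
  (Subₚ.x∈p⇒∣p-x∣<∣p∣ x∈p)

length≤order : ∀ {xs : List (Fin n)} → Unique xs → length xs ≤ n
length≤order xs! = ℕₚ.≤-trans (length≤card ⊤ xs! (All.universal (λ _ → Subₚ.∈⊤) _)) (Subₚ.∣p∣≤n ⊤)

-- Otherwise `h`, `x`, `h′`, `y` would form a cycle of length four.
common-neighbour : ∀ {G : Graph n} → Acyclic G → ∀ {h h′ x y} → h ≢ h′ →
                   Adj G h x → Adj G h y → Adj G h′ x → Adj G h′ y → x ≡ y
common-neighbour {G = G} acyc {h} {h′} {x} {y} h≢h′ hx hy h′x h′y with x ≟ y
... | yes x≡y = x≡y
... | no  x≢y = contradiction (simple⇒cycle path simple (adj-sym G hy)) acyc
  where
  path : Walk G h y 3
  path = cons hx (cons (adj-sym G h′x) (cons h′y nil))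
  simple : Simple path
  simple = (λ { zero → adj-irrefl G hx ∘ sym ; (suc zero) → h≢h′ ∘ sym
              ; (suc (suc zero)) → adj-irrefl G hy ∘ sym })
         , (λ { zero → adj-irrefl G h′x ; (suc zero) → x≢y ∘ sym })
         , (λ { zero → adj-irrefl G h′y ∘ sym })
         , _

module _ {A : Set} {P Q : A → Set} (P? : ∀ x → Dec (P x))
         (P-unique : ∀ {x y} → Q x → Q y → P x → P y → x ≡ y) where

  length-filter-unique : ∀ {xs} → Unique xs → All Q xs →
                         length xs ≤ suc (length (filter (¬? ∘ P?) xs))
  length-filter-unique []         []         = z≤n
  length-filter-unique {x ∷ xs} (x∉ ∷ xs!) (qx ∷ qxs) with P? x
  ... | no  ¬px = s≤s (length-filter-unique xs! qxs)
  -- Uniqueness rules out a second hit, so the filter leaves the tail intact.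
  ... | yes px  = s≤s (ℕₚ.≤-reflexive (cong length (sym (Listₚ.filter-all (¬? ∘ P?)
        (All.zipWith (λ { (qy , x≢y) py → x≢y (P-unique qx qy px py) }) (qxs , x∉))))))

-- The number k(k - 1)/2 of unordered pairs of hubs, each of which may cost one shared neighbour.
triangle : ℕ → ℕ
triangle zero    = 0
triangle (suc k) = k + triangle k

module _ {G : Graph n} (acyc : Acyclic G) where

  -- Each hub of `hs` differs from `h` and so shares at most one neighbour with it; avoiding its
  -- neighbourhood costs at most one entry.
  strip : ∀ {h} (hs : List (Fin n)) → All (h ≢_) hs → ∀ {xs} → Unique xs → All (Adj G h) xs →
          Σ[ ys ∈ List (Fin n) ] (Unique ys × All (Adj G h) ys ×
            All (λ y → All (λ h′ → ¬ Adj G h′ y) hs) ys × length xs ≤ length hs + length ys)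
  strip []       []          xs! adjs = _ , xs! , adjs , All.universal (λ _ → []) _ , ℕₚ.≤-refl
  strip {h} (h′ ∷ hs) (h≢h′ ∷ h∉) {xs} xs! adjs with strip hs h∉ xs! adjs
  ... | ys , ys! , ys-adj , ys-far , xs≤ =
    filter far? ys , Uniqueₚ.filter⁺ far? ys! , Allₚ.filter⁺ far? ys-adj ,
    All.zipWith (λ { (f , fs) → f ∷ fs }) (Allₚ.all-filter far? ys , Allₚ.filter⁺ far? ys-far) ,
    (begin
      length xs                                   ≤⟨ xs≤ ⟩
      length hs + length ys                       ≤⟨ ℕₚ.+-monoʳ-≤ (length hs) fewer ⟩
      length hs + suc (length (filter far? ys))   ≡⟨ ℕₚ.+-suc (length hs) _ ⟩
      suc (length hs + length (filter far? ys))   ∎)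
    where
    open ℕₚ.≤-Reasoning
    near? : ∀ y → Dec (Adj G h′ y)
    near? y = adj G h′ y ≟ᵇ true
    far? : ∀ y → Dec (¬ Adj G h′ y)
    far? = ¬? ∘ near?
    fewer : length ys ≤ suc (length (filter far? ys))
    fewer = length-filter-unique {Q = Adj G h} near? (common-neighbour acyc h≢h′) ys! ys-adj

  -- Leaves are collected hub by hub. Those of `h` are stripped of all neighbours of `hs`; the `Any`
  -- component places every vertex collected so far next to a hub of `hs`, whence disjointness.
  packing : ∀ {d hs} → Unique hs → All (Star G d) hs →
            Σ[ xs ∈ List (Fin n) ] (Unique xs × All (λ x → Any (λ h → Adj G h x) hs) xs ×
              length hs * d ≤ length xs + triangle (length hs))
  packing []         []       = [] , [] , [] , z≤n
  packing {d} {h ∷ hs} (h∉ ∷ hs!) (s ∷ ss) with packing hs! ss | strip hs h∉ (unique s) (adjacent s)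
  ... | xs , xs! , xs-near , xs-long | ys , ys! , ys-adj , ys-far , ys-long =
    ys ++ xs ,
    Uniqueₚ.++⁺ ys! xs! (λ { (∈ys , ∈xs) → Allₚ.All¬⇒¬Any (All.lookup ys-far ∈ys) (All.lookup xs-near ∈xs) }) ,
    Allₚ.++⁺ (All.map here ys-adj) (All.map there xs-near) ,
    (begin
      d + length hs * d
        ≤⟨ ℕₚ.+-mono-≤ (ℕₚ.≤-trans (ℕₚ.≤-reflexive (sym (degree s))) ys-long) xs-long ⟩
      (length hs + length ys) + (length xs + triangle (length hs))
        ≡⟨ solve 4 (λ a b c e → (a :+ b) :+ (c :+ e) := (b :+ c) :+ (a :+ e)) refl
             (length hs) (length ys) (length xs) (triangle (length hs)) ⟩
      (length ys + length xs) + (length hs + triangle (length hs))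
        ≡⟨ cong (_+ (length hs + triangle (length hs))) (sym (Listₚ.length-++ ys)) ⟩
      length (ys ++ xs) + (length hs + triangle (length hs)) ∎)
    where
    open ℕₚ.≤-Reasoning
    open +-*-Solver

  packing-bound : ∀ {d hs} → Unique hs → All (Star G d) hs →
                  length hs * d ≤ n + triangle (length hs)
  packing-bound {hs = hs} hs! ss with packing hs! ss
  ... | xs , xs! , _ , xs-long =
    ℕₚ.≤-trans xs-long (ℕₚ.+-monoˡ-≤ (triangle (length hs)) (length≤order xs!))

-- Four hubs in a tree

module _ {G : Graph n} (conn : Connected G) (acyc : Acyclic G) (root : Fin n) where

  -- A proper two-colouring. Any walk from `root` serves, since closed walks are even.
  colour : Fin n → Parity
  colour v = parity (proj₁ (conn root v))

  -- The closed walk from `root` to `u`, along `p` to `v` and back is even.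
  colour-walk : ∀ {u v} → Walk G u v k → colour u ℙ+ (parity k ℙ+ colour v) ≡ 0ℙ
  colour-walk {k} {u} {v} p =
    trans (cong (colour u ℙ+_) (sym (Parityₚ.+-homo-+ k _)))
      (trans (sym (Parityₚ.+-homo-+ (proj₁ (conn root u)) _))
        (acyclic⇒even acyc (proj₂ (conn root u) ++ʷ (p ++ʷ reverseʷ (proj₂ (conn root v))))))

  colour-even : ∀ {u v} → Walk G u v k → parity k ≡ 0ℙ → colour u ≡ colour v
  colour-even {k} {u} {v} p even with colour u | colour v | parity k | colour-walk p
  colour-even p refl | 0ℙ | 0ℙ | _ | _ = refl
  colour-even p refl | 1ℙ | 1ℙ | _ | _ = refl

  colour-odd : ∀ {u v} → Walk G u v k → parity k ≡ 1ℙ → colour u ≢ colour v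
  colour-odd {k} {u} {v} p odd with colour u | colour v | parity k | colour-walk p
  colour-odd p refl | 0ℙ | 1ℙ | _ | _ = λ ()
  colour-odd p refl | 1ℙ | 0ℙ | _ | _ = λ ()

  module _ {Hub : Fin n → Set} {a₂ b₂ a₃ b₃ a₄ b₄}
           (A₂ : Hub a₂) (B₂ : Hub b₂) (A₃ : Hub a₃) (B₃ : Hub b₃) (A₄ : Hub a₄) (B₄ : Hub b₄)
           (d₂ : Dist G a₂ b₂ 2) (d₃ : Dist G a₃ b₃ 3) (d₄ : Dist G a₄ b₄ 4) where

    FourHubs : Set
    FourHubs = Σ[ hs ∈ List (Fin n) ] (Unique hs × All Hub hs × length hs ≡ 4)

    -- The ends of an odd walk differ in colour, so the two hubs at distance three cannot both have
    -- colour `c`.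
    off-colour : ∀ c → ∃[ z ] (Hub z × colour z ≢ c)
    off-colour c with colour a₃ Parityₚ.≟ c
    ... | no  a≢c = a₃ , A₃ , a≢c
    ... | yes a≡c = b₃ , B₃ , λ b≡c → colour-odd (proj₁ d₃) refl (trans a≡c (sym b≡c))

    apart : ∀ {x y d} → Dist G x y (suc d) → x ≢ y
    apart d refl with Dist-unique d (nil , λ _ ())
    ... | ()

    -- Even distances give `x`, `y`, `z` one colour, and `y` differs from `z` because 2 differs from
    -- 4. A hub of the other colour is the fourth.
    shared : ∀ {x y z} → Hub x → Hub y → Hub z → Dist G x y 2 → Dist G x z 4 → FourHubs
    shared {x} {y} {z} X Y Z dxy dxz with off-colour (colour x)
    ... | w , W , w≢x =
      w ∷ x ∷ y ∷ z ∷ [] ,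
      ((w≢x ∘ cong colour) ∷ (λ w≡y → w≢x (trans (cong colour w≡y) (sym (colour-even (proj₁ dxy) refl))))
        ∷ (λ w≡z → w≢x (trans (cong colour w≡z) (sym (colour-even (proj₁ dxz) refl)))) ∷ [])
      ∷ (apart dxy ∷ apart dxz ∷ [])
      ∷ (y≢z ∷ []) ∷ [] ∷ [] ,
      W ∷ X ∷ Y ∷ Z ∷ [] , refl
      where
      y≢z : y ≢ z
      y≢z refl with Dist-unique dxy dxz
      ... | ()

    four-hubs : FourHubs
    four-hubs with a₂ ≟ a₄ | a₂ ≟ b₄ | b₂ ≟ a₄ | b₂ ≟ b₄
    ... | yes refl | _ | _ | _ = shared A₂ B₂ B₄ d₂ d₄
    ... | _ | yes refl | _ | _ = shared A₂ B₂ A₄ d₂ (Dist-sym d₄)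
    ... | _ | _ | yes refl | _ = shared B₂ A₂ B₄ (Dist-sym d₂) d₄
    ... | _ | _ | _ | yes refl = shared B₂ A₂ A₄ (Dist-sym d₂) (Dist-sym d₄)
    -- Without a coincidence, the ends of the pairs at distances two and four are already four hubs.
    ... | no aa | no ab | no ba | no bb =
      a₂ ∷ b₂ ∷ a₄ ∷ b₄ ∷ [] ,
      (apart d₂ ∷ aa ∷ ab ∷ []) ∷ (ba ∷ bb ∷ []) ∷ (apart d₄ ∷ []) ∷ [] ∷ [] ,
      A₂ ∷ B₂ ∷ A₄ ∷ B₄ ∷ [] , refl

-- Pathwidth

∣p∪q∣≤∣p∣+∣q∣ : ∀ (p q : Subset n) → ∣ p ∪ q ∣ ≤ ∣ p ∣ + ∣ q ∣
∣p∪q∣≤∣p∣+∣q∣ []            []            = z≤n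
∣p∪q∣≤∣p∣+∣q∣ (outside ∷ p) (outside ∷ q) = ∣p∪q∣≤∣p∣+∣q∣ p q
∣p∪q∣≤∣p∣+∣q∣ (outside ∷ p) (inside  ∷ q) =
  ℕₚ.≤-trans (s≤s (∣p∪q∣≤∣p∣+∣q∣ p q)) (ℕₚ.≤-reflexive (sym (ℕₚ.+-suc ∣ p ∣ ∣ q ∣)))
∣p∪q∣≤∣p∣+∣q∣ (inside ∷ p)  (outside ∷ q) = s≤s (∣p∪q∣≤∣p∣+∣q∣ p q)
∣p∪q∣≤∣p∣+∣q∣ (inside ∷ p)  (inside  ∷ q) =
  s≤s (ℕₚ.≤-trans (∣p∪q∣≤∣p∣+∣q∣ p q) (ℕₚ.+-monoʳ-≤ ∣ p ∣ (ℕₚ.n≤1+n ∣ q ∣)))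

-- The first bag holds both marked vertices, so {u, v} plus a new neighbour of u can be put before it.
record Sweep (G : Graph n) (u v : Fin n) : Set where
  field
    decomposition : PathDecomposition G
  open PathDecomposition decomposition public
  field
    width     : WidthAtMost decomposition 2
    top       : Fin r
    top-first : ∀ (i : Fin r) → top ≤ᶠ i
    u∈top     : u ∈ₛ bag top
    v∈top     : v ∈ₛ bag top

sweep-swap : ∀ {G : Graph n} {u v} → Sweep G u v → Sweep G v u
sweep-swap S = record
  { decomposition = decomposition ; width = width ; top = top ; top-first = top-first
  ; u∈top = v∈top ; v∈top = u∈top }
  where open Sweep S

sweep-point : Sweep point zero zero
sweep-point = record
  { decomposition = record
    { r        = 1
    ; bag      = λ _ → ⊤
    ; cover-v  = λ _ → zero , Subₚ.∈⊤
    ; cover-e  = λ _ _ ()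
    ; interval = λ _ _ _ _ _ _ _ _ → Subₚ.∈⊤
    }
  ; width = λ _ → s≤s z≤n ; top = zero ; top-first = λ _ → z≤n ; u∈top = here ; v∈top = here }

module _ {G : Graph n} {u v} (S : Sweep G u v) where
  open Sweep S

  private
    bag′ : Fin (suc r) → Subset (suc n)
    bag′ zero    = inside ∷ (⁅ u ⁆ ∪ ⁅ v ⁆)
    bag′ (suc i) = outside ∷ bag i

    u∈ : suc u ∈ₛ bag′ zero
    u∈ = there (Subₚ.x∈p∪q⁺ (inj₁ (Subₚ.x∈⁅x⁆ u)))

    v∈ : suc v ∈ₛ bag′ zero
    v∈ = there (Subₚ.x∈p∪q⁺ (inj₂ (Subₚ.x∈⁅x⁆ v)))

    ∈top : ∀ {w} → suc w ∈ₛ bag′ zero → w ∈ₛ bag top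
    ∈top (there w∈) with Subₚ.x∈p∪q⁻ ⁅ u ⁆ ⁅ v ⁆ w∈
    ... | inj₁ w∈u = subst (_∈ₛ bag top) (sym (Subₚ.x∈⁅y⁆⇒x≡y u w∈u)) u∈top
    ... | inj₂ w∈v = subst (_∈ₛ bag top) (sym (Subₚ.x∈⁅y⁆⇒x≡y v w∈v)) v∈top

    cover-v′ : ∀ w → ∃[ i ] w ∈ₛ bag′ i
    cover-v′ zero    = zero , here
    cover-v′ (suc w) = let i , w∈ = cover-v w in suc i , there w∈

    cover-e′ : ∀ x y → Adj (pend G u) x y → ∃[ i ] (x ∈ₛ bag′ i × y ∈ₛ bag′ i)
    cover-e′ zero    (suc y) e = zero , here , subst (λ z → suc z ∈ₛ bag′ zero) (sym (does⇒≡ e)) u∈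
    cover-e′ (suc x) zero    e = zero , subst (λ z → suc z ∈ₛ bag′ zero) (sym (does⇒≡ e)) u∈ , here
    cover-e′ (suc x) (suc y) e = let i , x∈ , y∈ = cover-e x y e in suc i , there x∈ , there y∈

    interval′ : ∀ w i j k → i ≤ᶠ j → j ≤ᶠ k → w ∈ₛ bag′ i → w ∈ₛ bag′ k → w ∈ₛ bag′ j
    interval′ w       zero    zero    k       _         _         w∈ _           = w∈
    -- An old vertex of the new bag lies in the old first bag `top`, so its old interval can be
    -- taken to start there.
    interval′ (suc w) zero    (suc j) (suc k) _         (s≤s j≤k) w∈ (there w∈k) =
      there (interval w top j k (top-first j) j≤k (∈top w∈) w∈k)
    interval′ (suc w) (suc i) (suc j) (suc k) (s≤s i≤j) (s≤s j≤k) (there w∈i) (there w∈k) =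
      there (interval w i j k i≤j j≤k w∈i w∈k)

    width′ : ∀ i → ∣ bag′ i ∣ ≤ 3
    width′ zero    = s≤s (ℕₚ.≤-trans (∣p∪q∣≤∣p∣+∣q∣ ⁅ u ⁆ ⁅ v ⁆)
      (ℕₚ.≤-reflexive (cong₂ _+_ (Subₚ.∣⁅x⁆∣≡1 u) (Subₚ.∣⁅x⁆∣≡1 v))))
    width′ (suc i) = width i

    extend : ∀ {x y} → x ∈ₛ bag′ zero → y ∈ₛ bag′ zero → Sweep (pend G u) x y
    extend x∈ y∈ = record
      { decomposition = record
        { r = suc r ; bag = bag′ ; cover-v = cover-v′ ; cover-e = cover-e′ ; interval = interval′ }
      ; width = width′ ; top = zero ; top-first = λ _ → z≤n ; u∈top = x∈ ; v∈top = y∈ }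

  -- The new first bag offers several next marked pairs. `sweep-keep` serves repeated leaves,
  -- `sweep-advance` progress along a path with `v` kept behind, `sweep-stretch` followed by
  -- `sweep-return` a leg, and `sweep-forget` a fresh start at the new vertex.
  sweep-keep : Sweep (pend G u) (suc u) (suc v)
  sweep-keep = extend u∈ v∈

  sweep-advance : Sweep (pend G u) zero (suc v)
  sweep-advance = extend here v∈

  sweep-stretch : Sweep (pend G u) zero (suc u)
  sweep-stretch = extend here u∈

  sweep-forget : Sweep (pend G u) zero zero
  sweep-forget = extend here here

  sweep-return : Sweep (pend G u) (suc v) (suc v)
  sweep-return = extend v∈ v∈

-- The distinctness fields serve to count three vertices in one bag: the centre with two knees, or
-- with a knee and its foot.
record Spider (G : Graph n) : Set where
  field
    centre     : Fin n
    knee foot  : Fin 3 → Fin n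
    thigh      : ∀ i → Adj G centre (knee i)
    shin       : ∀ i → Adj G (knee i) (foot i)
    foot≢      : ∀ i → foot i ≢ centre
    knee-inj   : ∀ {i j} → i ≢ j → knee i ≢ knee j

module _ {G : Graph n} (S : Spider G) (D : PathDecomposition G) where
  open Spider S
  open PathDecomposition D

  private
    crowded : ∀ {x y z} i → x ≢ y → x ≢ z → y ≢ z →
              x ∈ₛ bag i → y ∈ₛ bag i → z ∈ₛ bag i → ∃[ j ] 3 ≤ ∣ bag j ∣
    crowded i x≢y x≢z y≢z x∈ y∈ z∈ = i ,
      length≤card (bag i) ((x≢y ∷ x≢z ∷ []) ∷ (y≢z ∷ []) ∷ [] ∷ []) (x∈ ∷ y∈ ∷ z∈ ∷ [])

    pos : Fin 3 → Fin r
    pos i = proj₁ (cover-e centre (knee i) (thigh i))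

    centre∈ : ∀ i → centre ∈ₛ bag (pos i)
    centre∈ i = proj₁ (proj₂ (cover-e centre (knee i) (thigh i)))

    knee∈ : ∀ i → knee i ∈ₛ bag (pos i)
    knee∈ i = proj₂ (proj₂ (cover-e centre (knee i) (thigh i)))

    clash : ∀ i j → i ≢ j → knee i ∈ₛ bag (pos j) → ∃[ k ] 3 ≤ ∣ bag k ∣
    clash i j i≢j ∈j = crowded (pos j) (adj-irrefl G (thigh i)) (adj-irrefl G (thigh j)) (knee-inj i≢j)
      (centre∈ j) ∈j (knee∈ j)

    -- The bag of the shin of the middle leg j lies beside or between the bags of the other thighs.
    middle : ∀ i j k → j ≢ i → j ≢ k → pos i ≤ᶠ pos j → pos j ≤ᶠ pos k → ∃[ l ] 3 ≤ ∣ bag l ∣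
    middle i j k j≢i j≢k i≤j j≤k with cover-e (knee j) (foot j) (shin j)
    ... | q , knee∈q , foot∈q with ℕₚ.≤-total (toℕ q) (toℕ (pos i)) | ℕₚ.≤-total (toℕ q) (toℕ (pos k))
    -- Beside: the interval of the knee, from shin bag to thigh bag, crosses the thigh bag of an
    -- outer leg.
    ...   | inj₁ q≤i | _        =
      clash j i j≢i (interval _ q (pos i) (pos j) q≤i i≤j knee∈q (knee∈ j))
    ...   | inj₂ _   | inj₂ k≤q =
      clash j k j≢k (interval _ (pos j) (pos k) q j≤k k≤q (knee∈ j) knee∈q)
    -- Between: the interval of the centre covers `q`, which then holds centre, knee and foot.
    ...   | inj₂ i≤q | inj₁ q≤k =
      crowded q (adj-irrefl G (thigh j)) (foot≢ j ∘ sym) (adj-irrefl G (shin j))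
        (interval _ (pos i) q (pos k) i≤q q≤k (centre∈ i) (centre∈ k)) knee∈q foot∈q

  spider-bag : ∃[ i ] 3 ≤ ∣ bag i ∣
  spider-bag with ℕₚ.≤-total (toℕ (pos (# 0))) (toℕ (pos (# 1)))
                | ℕₚ.≤-total (toℕ (pos (# 1))) (toℕ (pos (# 2)))
                | ℕₚ.≤-total (toℕ (pos (# 0))) (toℕ (pos (# 2)))
  ... | inj₁ p | inj₁ q | _      = middle (# 0) (# 1) (# 2) (λ ()) (λ ()) p q
  ... | inj₁ p | inj₂ q | inj₁ r = middle (# 0) (# 2) (# 1) (λ ()) (λ ()) r q
  ... | inj₁ p | inj₂ q | inj₂ r = middle (# 2) (# 0) (# 1) (λ ()) (λ ()) r p
  ... | inj₂ p | inj₂ q | _      = middle (# 2) (# 1) (# 0) (λ ()) (λ ()) q p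
  ... | inj₂ p | inj₁ q | inj₁ r = middle (# 1) (# 0) (# 2) (λ ()) (λ ()) p r
  ... | inj₂ p | inj₁ q | inj₂ r = middle (# 1) (# 2) (# 0) (λ ()) (λ ()) q r

sweep∧spider⇒pathwidth : ∀ {G : Graph n} {u v} → Sweep G u v → Spider G → Pathwidth G 2
sweep∧spider⇒pathwidth S sp = (decomposition , width) , λ D w D≤w →
  let i , 3≤ = spider-bag sp D in ℕₚ.≤-pred (ℕₚ.≤-trans 3≤ (D≤w i))
  where open Sweep S

-- Exhaustive search

Searchable : Set → Set₁
Searchable A = ∀ {P : A → Set} → (∀ x → Dec (P x)) → Dec (∃ P)

searchBool : Searchable Bool
searchBool P? = map′ (λ { (inj₁ p) → _ , p ; (inj₂ p) → _ , p })
  (λ { (false , p) → inj₁ p ; (true , p) → inj₂ p }) (P? false ⊎-dec P? true)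

-- Maps between finite sets and Boolean matrices are represented as vectors, which can be searched
-- by recursion on the length.
searchVec : ∀ {A} → Searchable A → ∀ n → Searchable (Vec A n)
searchVec search zero    P? = map′ ([] ,_) (λ { ([] , p) → p }) (P? [])
searchVec search (suc n) P? = map′ (λ { (x , xs , p) → x ∷ xs , p }) (λ { (x ∷ xs , p) → x , xs , p })
  (search λ x → searchVec search n λ xs → P? (x ∷ xs))

module _ {H : Graph m} (conn : Connected H) (G : Graph n) where

  private
    δ : Fin m → Fin m → ℕ
    δ u v = proj₁ (distance conn u v)

    δ-dist : ∀ u v → Dist H u v (δ u v)
    δ-dist u v = proj₂ (distance conn u v)

  -- Connectedness gives every pair in `H` a finite distance, so `f-dist`, which ranges over all
  -- `d`, reduces to one decidable check per pair.
  Preserves : (Fin m → Fin n) → Set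
  Preserves φ = ∀ u v → Dist G (φ u) (φ v) (δ u v)

  -- Equality is distance zero and adjacency is distance one, so injectivity and edges come from
  -- distances alone.
  preserves⇒embedding : ∀ φ → Preserves φ → IsometricEmbedding H G
  preserves⇒embedding φ pres = record
    { f = φ
    ; f-inj = λ {u} {v} eq → walk₀ (subst (Walk H u v) (sym (Dist-unique (point₀ eq) (pres u v))) (proj₁ (δ-dist u v)))
    ; f-edge = λ u v e → walk₁ (subst (Walk G (φ u) (φ v)) (Dist-unique (δ-dist u v) (edge₁ e)) (proj₁ (pres u v)))
    ; f-dist = λ u v d → mk⇔
        (λ D → subst (Dist G (φ u) (φ v)) (Dist-unique (δ-dist u v) D) (pres u v))
        (λ D → subst (Dist H u v) (Dist-unique (pres u v) D) (δ-dist u v))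
    }
    where
    walk₀ : ∀ {l} {K : Graph l} {u v} → Walk K u v 0 → u ≡ v
    walk₀ nil = refl
    walk₁ : ∀ {l} {K : Graph l} {u v} → Walk K u v 1 → Adj K u v
    walk₁ (cons e nil) = e
    point₀ : ∀ {l} {K : Graph l} {u v} → u ≡ v → Dist K u v 0
    point₀ refl = nil , λ _ ()
    edge₁ : ∀ {u v} → Adj H u v → Dist H u v 1
    edge₁ e = cons e nil , λ { zero _ p → adj-irrefl H e (walk₀ p) ; (suc _) (s≤s ()) }

  embedding? : Dec (IsometricEmbedding H G)
  embedding? = map′ (λ { (φ , pres) → preserves⇒embedding (lookup φ) pres }) complete
    (searchVec any? m λ φ → all? λ u → all? λ v → dist? G (lookup φ u) (lookup φ v) (δ u v))
    where
    complete : IsometricEmbedding H G → ∃[ φ ] Preserves (lookup φ)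
    complete α = tabulate (f α) , λ u v →
      subst₂ (λ x y → Dist G x y (δ u v)) (sym (Vecₚ.lookup∘tabulate (f α) u)) (sym (Vecₚ.lookup∘tabulate (f α) v))
        (Equivalence.to (f-dist α u v (δ u v)) (δ-dist u v))

-- Symmetrising and clearing the diagonal turns every Boolean matrix into a graph.
fromMatrix : Vec (Vec Bool n) n → Graph n
fromMatrix M = record
  { adj   = λ u v → (M [ u , v ] ∧ M [ v , u ]) ∧ not (does (u ≟ v))
  ; sym   = λ u v → cong₂ (λ b c → b ∧ not c) (∧-comm (M [ u , v ]) (M [ v , u ])) (≟-sym u v)
  ; irrfl = λ u → trans (cong (λ c → (M [ u , u ] ∧ M [ u , u ]) ∧ not c) (dec-true (u ≟ u) refl)) (∧-zeroʳ _)
  }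
  where
  _[_,_] : Vec (Vec Bool _) _ → Fin _ → Fin _ → Bool
  M [ u , v ] = lookup (lookup M u) v
  ≟-sym : ∀ (u v : Fin n) → does (u ≟ v) ≡ does (v ≟ u)
  ≟-sym u v with u ≟ v | v ≟ u
  ... | yes _    | yes _    = refl
  ... | no  _    | no  _    = refl
  ... | yes refl | no  v≢u  = contradiction refl v≢u
  ... | no  u≢v  | yes refl = contradiction refl u≢v

toMatrix : Graph n → Vec (Vec Bool n) n
toMatrix G = tabulate λ u → tabulate (adj G u)

fromMatrix∘toMatrix : ∀ (G : Graph n) u v → adj (fromMatrix (toMatrix G)) u v ≡ adj G u v
fromMatrix∘toMatrix G u v = trans (cong (_∧ not (does (u ≟ v))) (cong₂ _∧_ (entry u v) (entry v u))) restore
  where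
  entry : ∀ x y → lookup (lookup (toMatrix G) x) y ≡ adj G x y
  entry x y = trans (cong (λ row → lookup row y) (Vecₚ.lookup∘tabulate (tabulate ∘ adj G) x))
                    (Vecₚ.lookup∘tabulate (adj G x) y)
  restore : (adj G u v ∧ adj G v u) ∧ not (does (u ≟ v)) ≡ adj G u v
  restore with u ≟ v
  ... | yes refl = trans (∧-zeroʳ _) (sym (irrfl G u))
  ... | no  _    = trans (∧-identityʳ _) (trans (cong (adj G u v ∧_) (sym (Graph.sym G u v))) (∧-idem _))

module _ {i : ℕ} {sz : Fin i → ℕ} (F : ∀ j → Graph (sz j)) (conn : ∀ j → Connected (F j)) where

  universal? : ∀ m → Dec (Σ[ G ∈ Graph m ] IsIsoUniversal F G)
  universal? m = map′ (λ { (M , univ) → fromMatrix M , univ }) complete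
    (searchVec (searchVec searchBool m) m λ M → all? λ j → embedding? (conn j) (fromMatrix M))
    where
    complete : Σ[ G ∈ Graph m ] IsIsoUniversal F G → ∃[ M ] IsIsoUniversal F (fromMatrix M)
    -- The decoded graph agrees with `G` only entrywise, so the embeddings are composed with the
    -- identity, seen as a retract.
    complete (G , univ) = toMatrix G , λ j → embedding-∘ (Retract⇒embedding same) (univ j)
      where
      same : Retract G (fromMatrix (toMatrix G))
      same = record
        { ι = id ; ρ = id ; ρ∘ι = λ _ → refl
        ; ι-edge = λ u v e → trans (fromMatrix∘toMatrix G u v) e
        ; ρ-edge = λ u v e → inj₂ (trans (sym (fromMatrix∘toMatrix G u v)) e) }

  -- Decidability at each order makes the least order computable; the given graph bounds the search.
  minimum-universal : ∀ {m} {G : Graph m} → IsIsoUniversal F G →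
                      Σ[ n ∈ ℕ ] Σ[ U ∈ Graph n ] (IsMinimumIsoUniversal F U × n ≤ m)
  minimum-universal {m} {G} univ with least universal? (G , univ)
  ... | n , (U , univU) , n-min = n , U , (univU , below) , below m G univ
    where
    below : ∀ m (G : Graph m) → IsIsoUniversal F G → n ≤ m
    below m G univ = ℕₚ.≮⇒≥ λ m<n → n-min m m<n (G , univ)

-- Graphs grown from a base by pendant vertices and legs

-- New vertices are put in front and shift all indices; `inc` keeps track of the base vertices, to
-- which leaves and legs are attached.
record Based (b n : ℕ) : Set where
  constructor based
  field
    graph : Graph n
    inc   : Fin b → Fin n

open Based

base : Graph n → Based n n
base G = based G id

leaf : Based k n → Fin k → Based k (suc n)
leaf X i = based (pend (graph X) (inc X i)) (suc ∘ inc X)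

leg : Based k n → Fin k → Based k (2 + n)
leg X i = based (pend (graph (leaf X i)) zero) (λ j → suc (suc (inc X j)))

addLeaves : ∀ d → Based k n → Fin k → Based k (d + n)
addLeaves zero    X i = X
addLeaves (suc d) X i = leaf (addLeaves d X i) i

-- The three legs make the hub the centre of a spider; the extra leaf makes the order of the final
-- trees even, as `2 * t ^ 3 + 2` demands.
decorate : Based k n → Fin k → Based k (7 + n)
decorate X i = leg (leg (leg (leaf X i) i) i) i

leaf-edge : (X : Based k n) (i : Fin k) → Adj (graph (leaf X i)) (inc (leaf X i) i) zero
leaf-edge X i = pend-edge′ (graph X) (inc X i)

leg-tree : (X : Based k n) (i : Fin k) → IsTree (graph X) → IsTree (graph (leg X i))
leg-tree X i = pend-tree zero ∘ pend-tree (inc X i)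

addLeaves-tree : ∀ d (X : Based k n) i → IsTree (graph X) → IsTree (graph (addLeaves d X i))
addLeaves-tree zero    X i = id
addLeaves-tree (suc d) X i = pend-tree (inc (addLeaves d X i) i) ∘ addLeaves-tree d X i

decorate-tree : (X : Based k n) (i : Fin k) → IsTree (graph X) → IsTree (graph (decorate X i))
decorate-tree X i = leg-tree (leg (leg (leaf X i) i) i) i ∘ leg-tree (leg (leaf X i) i) i ∘
                    leg-tree (leaf X i) i ∘ pend-tree (inc X i)

-- Sweeps, spiders and stars in grown graphs

BasedSweep : Based k n → Fin k → Fin k → Set
BasedSweep X i j = Sweep (graph X) (inc X i) (inc X j)

leg-sweep : ∀ (X : Based k n) i j → BasedSweep X i j → BasedSweep (leg X i) i i
leg-sweep X i j S = sweep-return (sweep-stretch S)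

addLeaves-sweep : ∀ d (X : Based k n) i j → BasedSweep X i j → BasedSweep (addLeaves d X i) i j
addLeaves-sweep zero    X i j = id
addLeaves-sweep (suc d) X i j = sweep-keep ∘ addLeaves-sweep d X i j

decorate-sweep : ∀ (X : Based k n) i j → BasedSweep X i j → BasedSweep (decorate X i) i i
decorate-sweep X i j = leg-sweep (leg (leg (leaf X i) i) i) i i ∘ leg-sweep (leg (leaf X i) i) i i ∘
                       leg-sweep (leaf X i) i j ∘ sweep-keep

decorate-spider : (X : Based k n) (i : Fin k) → Spider (graph (decorate X i))
decorate-spider X i = record
  { centre = inc (decorate X i) i ; knee = knee ; foot = foot
  ; thigh  = λ { zero → leaf-edge (leg (leg (leaf X i) i) i) i ; (suc zero) → leaf-edge (leg (leaf X i) i) i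
               ; (suc (suc zero)) → leaf-edge (leaf X i) i }
  ; shin     = λ { zero → refl ; (suc zero) → refl ; (suc (suc zero)) → refl }
  ; foot≢    = λ { zero () ; (suc zero) () ; (suc (suc zero)) () }
  ; knee-inj = λ i≢j → i≢j ∘ knee-injective _ _
  }
  where
  knee foot : Fin 3 → Fin (7 + _)
  -- The latest additions have the smallest indices: each leg contributes its foot, then its knee.
  knee zero             = suc zero
  knee (suc zero)       = suc (suc (suc zero))
  knee (suc (suc zero)) = suc (suc (suc (suc (suc zero))))
  foot zero             = zero
  foot (suc zero)       = suc (suc zero)
  foot (suc (suc zero)) = suc (suc (suc (suc zero)))
  knee-injective : ∀ i j → knee i ≡ knee j → i ≡ j
  knee-injective zero             zero             _ = refl
  knee-injective (suc zero)       (suc zero)       _ = refl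
  knee-injective (suc (suc zero)) (suc (suc zero)) _ = refl
  knee-injective zero             (suc zero)       ()
  knee-injective zero             (suc (suc zero)) ()
  knee-injective (suc zero)       zero             ()
  knee-injective (suc zero)       (suc (suc zero)) ()
  knee-injective (suc (suc zero)) zero             ()
  knee-injective (suc (suc zero)) (suc zero)       ()

BasedStar : Based k n → ℕ → Fin k → Set
BasedStar X d i = Star (graph X) d (inc X i)

leaf-star : ∀ (X : Based k n) i j {d} → BasedStar X d j → BasedStar (leaf X i) d j
leaf-star X i j = star-map suc Finₚ.suc-injective id

leg-star : ∀ (X : Based k n) i j {d} → BasedStar X d j → BasedStar (leg X i) d j
leg-star X i j = star-map suc Finₚ.suc-injective id ∘ leaf-star X i j

addLeaves-star : ∀ d (X : Based k n) i → BasedStar (addLeaves d X i) d i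
addLeaves-star zero    X i = record { leaves = [] ; unique = [] ; adjacent = [] ; degree = refl }
addLeaves-star (suc d) X i = record
  { leaves   = zero ∷ leaves s
  ; unique   = Allₚ.map⁺ (All.universal (λ _ ()) (leaves (addLeaves-star d X i))) ∷ unique s
  ; adjacent = leaf-edge (addLeaves d X i) i ∷ adjacent s
  ; degree   = cong suc (degree s)
  }
  where s = leaf-star (addLeaves d X i) i i (addLeaves-star d X i)

addLeaves-star-extend : ∀ d (X : Based k n) i j {c} → BasedStar X c j → BasedStar (addLeaves d X i) c j
addLeaves-star-extend zero    X i j = id
addLeaves-star-extend (suc d) X i j = leaf-star (addLeaves d X i) i j ∘ addLeaves-star-extend d X i j

decorate-star : ∀ (X : Based k n) i j {d} → BasedStar X d j → BasedStar (decorate X i) d j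
decorate-star X i j = leg-star (leg (leg (leaf X i) i) i) i j ∘ leg-star (leg (leaf X i) i) i j ∘
                      leg-star (leaf X i) i j ∘ leaf-star X i j

-- `ι∘inc` is what allows a further vertex to be attached at matching places on both sides.
record BasedRetract (e : Fin k → Fin l) (X : Based k m) (Y : Based l n) : Set where
  constructor _over_
  field
    retract : Retract (graph X) (graph Y)
    ι∘inc   : ∀ i → ι retract (inc X i) ≡ inc Y (e i)

open BasedRetract

module _ {e : Fin k → Fin l} {X : Based k m} {Y : Based l n} where

  leaf-extend : BasedRetract e X Y → ∀ j → BasedRetract e X (leaf Y j)
  leaf-extend (R over com) j = retract-pendʳ R (inc Y j) over (cong suc ∘ com)

  leaf-retract : BasedRetract e X Y → ∀ {i j} → e i ≡ j → BasedRetract e (leaf X i) (leaf Y j)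
  leaf-retract (R over com) {i} refl = retract-pend R (com i) over (cong suc ∘ com)

module _ {e : Fin k → Fin l} (X : Based k m) (Y : Based l n) where

  leg-extend : BasedRetract e X Y → ∀ j → BasedRetract e X (leg Y j)
  leg-extend R j = retract-pendʳ (retract R′) zero over (cong suc ∘ ι∘inc R′)
    where R′ = leaf-extend R j

  leg-retract : BasedRetract e X Y → ∀ {i j} → e i ≡ j → BasedRetract e (leg X i) (leg Y j)
  leg-retract R refl = retract-pend (retract R′) refl over (cong suc ∘ ι∘inc R′)
    where R′ = leaf-retract R refl

module _ {e : Fin k → Fin l} (X : Based k m) (Y : Based l n) where

  addLeaves-extend : ∀ d → BasedRetract e X Y → ∀ j → BasedRetract e X (addLeaves d Y j)
  addLeaves-extend zero    R j = R
  addLeaves-extend (suc d) R j = leaf-extend (addLeaves-extend d R j) j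

  addLeaves-retract : ∀ d → BasedRetract e X Y → ∀ {i j} → e i ≡ j →
                      BasedRetract e (addLeaves d X i) (addLeaves d Y j)
  addLeaves-retract zero    R ei≡j = R
  addLeaves-retract (suc d) R ei≡j = leaf-retract (addLeaves-retract d R ei≡j) ei≡j

  decorate-extend : BasedRetract e X Y → ∀ j → BasedRetract e X (decorate Y j)
  decorate-extend R j =
    leg-extend X Y₃ (leg-extend X Y₂ (leg-extend X Y₁ (leaf-extend R j) j) j) j
    where
    Y₁ = leaf Y j
    Y₂ = leg Y₁ j
    Y₃ = leg Y₂ j

  decorate-retract : BasedRetract e X Y → ∀ {i j} → e i ≡ j → BasedRetract e (decorate X i) (decorate Y j)
  decorate-retract R {i} {j} ei≡j =
    leg-retract X₃ Y₃ (leg-retract X₂ Y₂ (leg-retract X₁ Y₁ (leaf-retract R ei≡j) ei≡j) ei≡j) ei≡j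
    where
    X₁ = leaf X i
    X₂ = leg X₁ i
    X₃ = leg X₂ i
    Y₁ = leaf Y j
    Y₂ = leg Y₁ j
    Y₃ = leg Y₂ j

-- The three trees and the unicyclic universal graph

P₅ : Graph 5
P₅ = pend (pend (pend (pend point zero) zero) zero) zero

P₅-tree : IsTree P₅
P₅-tree = pend-tree _ (pend-tree _ (pend-tree _ (pend-tree _ point-tree)))

cycleAdj : Fin 9 → Fin 9 → Bool
cycleAdj u v = step u v ∨ step v u
  where
  step : Fin 9 → Fin 9 → Bool
  step u v = toℕ v ≡ᵇ (suc (toℕ u) % 9)

C₉ : Graph 9
C₉ = record
  { adj   = cycleAdj
  ; sym   = from-yes (all? λ u → all? λ v → cycleAdj u v ≟ᵇ cycleAdj v u)
  ; irrfl = from-yes (all? λ u → cycleAdj u u ≟ᵇ false)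
  }

-- The arc of length four that starts at s embeds P₅; the other arc is folded back onto it.
arc : ℕ → Fin 5 → Fin 9
arc s i = (s + toℕ i) mod 9

fold : ℕ → Fin 9 → Fin 5
-- Adding `9 ∸ s` rotates `s` to position 0. The other arc has five edges; the one from position 4
-- to position 5 is contracted, and the remaining four run back along the path.
fold s x = lookup (# 0 ∷ # 1 ∷ # 2 ∷ # 3 ∷ # 4 ∷ # 4 ∷ # 3 ∷ # 2 ∷ # 1 ∷ []) ((toℕ x + (9 ∸ s)) mod 9)

IsArcRetract : ℕ → Set
IsArcRetract s =
  (∀ u → fold s (arc s u) ≡ u) ×
  (∀ u v → Adj P₅ u v → Adj C₉ (arc s u) (arc s v)) ×
  (∀ x y → Adj C₉ x y → fold s x ≡ fold s y ⊎ Adj P₅ (fold s x) (fold s y))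

isArcRetract? : ∀ s → Dec (IsArcRetract s)
isArcRetract? s =
  all? (λ u → fold s (arc s u) ≟ u) ×-dec
  all? (λ u → all? λ v → (adj P₅ u v ≟ᵇ true) →-dec (adj C₉ (arc s u) (arc s v) ≟ᵇ true)) ×-dec
  all? (λ x → all? λ y → (adj C₉ x y ≟ᵇ true) →-dec
    ((fold s x ≟ fold s y) ⊎-dec (adj P₅ (fold s x) (fold s y) ≟ᵇ true)))

arc-retract : ∀ s → {True (isArcRetract? s)} → BasedRetract (arc s) (base P₅) (base C₉)
arc-retract s {w} = record
  { ι = arc s ; ρ = fold s ; ρ∘ι = proj₁ proof ; ι-edge = proj₁ (proj₂ proof) ; ρ-edge = proj₂ (proj₂ proof) }
  over λ _ → refl
  where
  proof : IsArcRetract s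
  proof = toWitness w

module _ (L : ℕ) where

  order : ℕ
  order = 7 + (L + (L + 5))

  half : Fin 5 → Based 5 (L + 5)
  half x = addLeaves L (base P₅) x

  core : Fin 5 → Fin 5 → Based 5 (L + (L + 5))
  core x y = addLeaves L (half x) y

  hubTree : Fin 5 → Fin 5 → Based 5 order
  hubTree x y = decorate (core x y) x

  hubTree-tree : ∀ x y → IsTree (graph (hubTree x y))
  hubTree-tree x y = decorate-tree (core x y) x
    (addLeaves-tree L (half x) y (addLeaves-tree L (base P₅) x P₅-tree))

  hubTree-pathwidth : ∀ x y → Sweep P₅ x y → Pathwidth (graph (hubTree x y)) 2
  hubTree-pathwidth x y S = sweep∧spider⇒pathwidth (decorate-sweep (core x y) x y S₂) (decorate-spider (core x y) x)
    where
    S₁ : BasedSweep (half x) x y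
    S₁ = addLeaves-sweep L (base P₅) x y S
    S₂ : BasedSweep (core x y) x y
    -- Only the first marked vertex takes new leaves, so the marks are exchanged before and after
    -- the leaves of `y`.
    S₂ = sweep-swap (addLeaves-sweep L (half x) y x (sweep-swap S₁))

  -- The path is isometric in the tree, so distances between hubs may be computed in `P₅`.
  hubTree-retract : ∀ x y → BasedRetract id (base P₅) (hubTree x y)
  hubTree-retract x y = decorate-extend P (core x y)
    (addLeaves-extend P (half x) L (addLeaves-extend P P L (retract-refl P₅ over λ _ → refl) x) y) x
    where P = base P₅

  hubTree-star₁ : ∀ x y → BasedStar (hubTree x y) L x
  hubTree-star₁ x y = decorate-star (core x y) x x
    (addLeaves-star-extend L (half x) y x (addLeaves-star L (base P₅) x))

  hubTree-star₂ : ∀ x y → BasedStar (hubTree x y) L y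
  hubTree-star₂ x y = decorate-star (core x y) x y (addLeaves-star L (half x) y)

  -- The hubs sit at 0, 2 and 5 on the 9-cycle, at pairwise distances 2, 3 and 4.
  Y₁ : Based 9 (L + 9)
  Y₁ = addLeaves L (base C₉) (# 0)

  Y₂ : Based 9 (L + (L + 9))
  Y₂ = addLeaves L Y₁ (# 2)

  Y₃ : Based 9 (L + (L + (L + 9)))
  Y₃ = addLeaves L Y₂ (# 5)

  Y₄ : Based 9 (7 + (L + (L + (L + 9))))
  Y₄ = decorate Y₃ (# 0)

  -- The trees laid on the arcs from 0 and from 5 both have their decorated hub at 0; the tree on
  -- the arc from 2 has it at 2.
  C₉⁺ : Based 9 (7 + (7 + (L + (L + (L + 9)))))
  C₉⁺ = decorate Y₄ (# 2)

  -- The hubs of the last tree are listed in reverse, so that its decorated hub is the end of the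
  -- arc from 5, which is 0.
  family : Fin 3 → Graph order
  family zero             = graph (hubTree (# 0) (# 2))
  family (suc zero)       = graph (hubTree (# 0) (# 3))
  family (suc (suc zero)) = graph (hubTree (# 4) (# 0))

  family-tree : ∀ i → IsTree (family i)
  family-tree zero             = hubTree-tree (# 0) (# 2)
  family-tree (suc zero)       = hubTree-tree (# 0) (# 3)
  family-tree (suc (suc zero)) = hubTree-tree (# 4) (# 0)

  -- `sweep-forget` moves both marks to the newest path vertex and `sweep-advance` only the first,
  -- so the number of advances is the distance between the hubs.
  family-pathwidth : ∀ i → Pathwidth (family i) 2
  family-pathwidth zero             = hubTree-pathwidth (# 0) (# 2)
    (sweep-advance (sweep-advance (sweep-forget (sweep-forget sweep-point))))
  family-pathwidth (suc zero)       = hubTree-pathwidth (# 0) (# 3)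
    (sweep-advance (sweep-advance (sweep-advance (sweep-forget sweep-point))))
  family-pathwidth (suc (suc zero)) = hubTree-pathwidth (# 4) (# 0)
    (sweep-swap (sweep-advance (sweep-advance (sweep-advance (sweep-advance sweep-point)))))

  -- Layer by layer, a part of `C₉⁺` is either matched with the same part of the tree or, by an
  -- `extend` lemma, folded away.
  retract₂ : BasedRetract (arc 0) (hubTree (# 0) (# 2)) C₉⁺
  retract₂ = decorate-extend (hubTree (# 0) (# 2)) Y₄
    (decorate-retract (core (# 0) (# 2)) Y₃
      (addLeaves-extend (core (# 0) (# 2)) Y₂ L
        (addLeaves-retract (half (# 0)) Y₁ L
          (addLeaves-retract (base P₅) (base C₉) L (arc-retract 0) refl) refl) (# 5)) refl) (# 2)

  retract₃ : BasedRetract (arc 2) (hubTree (# 0) (# 3)) C₉⁺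
  retract₃ = decorate-retract (core (# 0) (# 3)) Y₄
    (decorate-extend (core (# 0) (# 3)) Y₃
      (addLeaves-retract (half (# 0)) Y₂ L
        (addLeaves-retract (base P₅) Y₁ L
          (addLeaves-extend (base P₅) (base C₉) L (arc-retract 2) (# 0)) refl) refl) (# 0)) refl

  retract₄ : BasedRetract (arc 5) (hubTree (# 4) (# 0)) C₉⁺
  retract₄ = decorate-extend (hubTree (# 4) (# 0)) Y₄
    (decorate-retract (core (# 4) (# 0)) Y₃
      (addLeaves-retract (half (# 4)) Y₂ L
        (addLeaves-extend (half (# 4)) Y₁ L
          (addLeaves-retract (base P₅) (base C₉) L (arc-retract 5) refl) (# 2)) refl) refl) (# 2)

  family-universal : IsIsoUniversal family (graph C₉⁺)
  family-universal zero             = Retract⇒embedding (retract retract₂)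
  family-universal (suc zero)       = Retract⇒embedding (retract retract₃)
  family-universal (suc (suc zero)) = Retract⇒embedding (retract retract₄)

  -- Lower bound for universal trees

  module _ {U : Graph m} where

    hub-star : ∀ {x y} (α : IsometricEmbedding (graph (hubTree x y)) U) {z} →
               BasedStar (hubTree x y) L z → Star U L (f α (inc (hubTree x y) z))
    hub-star α = star-map (f α) (f-inj α) (f-edge α _ _)

    hub-dist : ∀ {x y} (α : IsometricEmbedding (graph (hubTree x y)) U) {d} → Dist P₅ x y d →
               Dist U (f α (inc (hubTree x y) x)) (f α (inc (hubTree x y) y)) d
    hub-dist {x} {y} α {d} D = Equivalence.to (f-dist α _ _ d)
      (subst₂ (λ u v → Dist (graph (hubTree x y)) u v d) (ι∘inc R x) (ι∘inc R y)
        (Equivalence.to (f-dist (Retract⇒embedding (retract R)) x y d) D))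
      where R = hubTree-retract x y

    tree-bound : IsTree U → IsIsoUniversal family U → 4 * L ≤ m + 6
    -- The root of the colouring is arbitrary; the image of a hub provides one.
    tree-bound (_ , conn , acyc) univ with four-hubs conn acyc (f α₃ (inc (hubTree (# 0) (# 3)) (# 0))) {Hub = Star U L}
        (hub-star α₂ (hubTree-star₁ (# 0) (# 2))) (hub-star α₂ (hubTree-star₂ (# 0) (# 2)))
        (hub-star α₃ (hubTree-star₁ (# 0) (# 3))) (hub-star α₃ (hubTree-star₂ (# 0) (# 3)))
        (hub-star α₄ (hubTree-star₁ (# 4) (# 0))) (hub-star α₄ (hubTree-star₂ (# 4) (# 0)))
        (hub-dist α₂ (from-yes (dist? P₅ (# 0) (# 2) 2)))
        (hub-dist α₃ (from-yes (dist? P₅ (# 0) (# 3) 3)))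
        (hub-dist α₄ (from-yes (dist? P₅ (# 4) (# 0) 4)))
      where
      α₂ = univ (# 0)
      α₃ = univ (# 1)
      α₄ = univ (# 2)
    ... | hs , hs! , ss , four = subst (λ h → h * L ≤ m + triangle h) four (packing-bound acyc hs! ss)

-- Abstracting the number of vertices lets the result be transported along an equation between
-- orders.
NoMinimumTree : ℕ → Set
NoMinimumTree N =
  Σ[ T ∈ (Fin 3 → Graph N) ]
    ((∀ i → IsTree (T i) × Pathwidth (T i) 2) ×
     (Σ[ n ∈ ℕ ] Σ[ G ∈ Graph n ]
        (IsMinimumIsoUniversal T G ×
         (∀ m (U : Graph m) → IsTree U → IsIsoUniversal T U → n < m))))

-- The minimum need not be identified: it has at most the `m` vertices of `G`, and every universal
-- tree has more.
gap⇒no-minimum-tree : (F : Fin 3 → Graph k) → (∀ i → IsTree (F i)) → (∀ i → Pathwidth (F i) 2) →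
                      ∀ {m} (G : Graph m) → IsIsoUniversal F G →
                      (∀ {l} (U : Graph l) → IsTree U → IsIsoUniversal F U → m < l) →
                      NoMinimumTree k
gap⇒no-minimum-tree F tree pathwidth G univ gap
  with minimum-universal F (λ i → proj₁ (proj₂ (tree i))) univ
... | n , U , minimum , n≤m =
  F , (λ i → tree i , pathwidth i) , n , U , minimum ,
  λ l V treeV univV → ℕₚ.≤-<-trans n≤m (gap V treeV univV)

-- `C₉⁺` has 3L + 23 vertices and a universal tree at least 4L - 6, which is more once L is at least
-- 30.
no-minimum-tree : ∀ L → 30 ≤ L → NoMinimumTree (order L)
no-minimum-tree L 30≤L =
  gap⇒no-minimum-tree (family L) (family-tree L) (family-pathwidth L) (graph (C₉⁺ L)) (family-universal L) gap
  where
  open ℕₚ.≤-Reasoning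
  open +-*-Solver
  gap : ∀ {l} (U : Graph l) → IsTree U → IsIsoUniversal (family L) U → 7 + (7 + (L + (L + (L + 9)))) < l
  gap {l} U tree univ = ℕₚ.+-cancelʳ-< 6 (7 + (7 + (L + (L + (L + 9))))) l (begin-strict
    7 + (7 + (L + (L + (L + 9)))) + 6
      ≡⟨ solve 1 (λ a → con 7 :+ (con 7 :+ (a :+ (a :+ (a :+ con 9)))) :+ con 6 := con 29 :+ con 3 :* a) refl L ⟩
    29 + 3 * L
      <⟨ ℕₚ.+-monoˡ-≤ (3 * L) 30≤L ⟩
    4 * L
      ≤⟨ tree-bound L tree univ ⟩
    l + 6 ∎)

theorem5 : ∀ (t : ℕ) → 9 ≤ t →
    Σ[ T ∈ (Fin 3 → Graph (2 * t ^ 3 + 2)) ]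
    ((∀ i → IsTree (T i) × Pathwidth (T i) 2) ×
    (Σ[ n ∈ ℕ ] Σ[ G ∈ Graph n ]
    (IsMinimumIsoUniversal T G ×
    (∀ m (U : Graph m) → IsTree U → IsIsoUniversal T U → n < m))))
theorem5 t 9≤t = subst NoMinimumTree size (no-minimum-tree L 30≤L)
  where
  open +-*-Solver
  L : ℕ
  -- Chosen because `order L` equals 2(L + 5) + 2.
  L = t ^ 3 ∸ 5
  35≤t³ : 35 ≤ t ^ 3
  -- 35 + 694 is the cube of 9.
  35≤t³ = ℕₚ.≤-trans (ℕₚ.m≤m+n 35 694) (ℕₚ.^-monoˡ-≤ 3 9≤t)
  30≤L : 30 ≤ L
  30≤L = ℕₚ.∸-monoˡ-≤ 5 35≤t³
  size : order L ≡ 2 * t ^ 3 + 2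
  size = trans
    (solve 1 (λ a → con 7 :+ (a :+ (a :+ con 5)) := con 2 :* (a :+ con 5) :+ con 2) refl L)
    (cong (λ c → 2 * c + 2) (ℕₚ.m∸n+n≡m (ℕₚ.≤-trans (ℕₚ.m≤m+n 5 30) 35≤t³)))
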